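{- For all positive integers $n$ and $k$, $$\sum_{r=1}^{k}(-1)^{k-r}\sum_{\substack{k_1+k_2+\cdots+k_r=k\\ k_i\geq 1}}\ \prod_{i=1}^{r}\binom{n}{k_i}=\binom{n+k-1}{k},$$ where the inner sum runs over all ordered $r$-tuples $(k_1,\dots,k_r)$ of positive integers with sum $k$ (i.e., over all compositions of $k$ into $r$ parts).
   Context: Binomial coefficients $\binom{m}{j}$ for nonnegative integers $m$ and $j$ are the usual ones, with $\binom{m}{j}=0$ when $j>m$. -}

module Defs where

open import Data.Integer.Base as ℤ using (ℤ)
open import Data.List.Base as List using (List; []; _∷_; applyUpTo; concatMap)
open import Data.List.Membership.Propositional using (_∈_; find; lose)
open import Data.List.Membership.Propositional.Properties
  using (∈-applyUpTo⁺; ∈-applyUpTo⁻; ∈-concatMap⁺; ∈-concatMap⁻; ∈-map⁺; ∈-map⁻)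
open import Data.List.Relation.Binary.Disjoint.Propositional using (Disjoint)
import Data.List.Relation.Unary.All as ListAll
open import Data.List.Relation.Unary.All.Properties using () renaming (map⁺ to All-map⁺)
open import Data.List.Relation.Unary.AllPairs as AllPairs using ()
open import Data.List.Relation.Unary.AllPairs.Properties using () renaming (map⁺ to AllPairs-map⁺)
open import Data.List.Relation.Unary.Any using (here)
open import Data.List.Relation.Unary.Unique.Propositional using (Unique)
open import Data.List.Relation.Unary.Unique.Propositional.Properties
  using (applyUpTo⁺₁; concat⁺) renaming (map⁺ to Unique-map⁺)
open import Data.Nat.Base using (ℕ; zero; suc; _+_; _*_; _∸_; _≤_; s≤s; z≤n)
open import Data.Nat.Properties using (<⇒≢; suc-injective; m+[n∸m]≡n; m+n∸m≡n; m≤m+n)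
open import Data.Product.Base using (_×_; _,_)
open import Data.Vec.Base as Vec using (Vec; []; _∷_)
open import Data.Vec.Properties using (∷-injectiveˡ; ∷-injectiveʳ)
open import Data.Vec.Relation.Unary.All using (All; []; _∷_)
open import Function.Base using (_∘_)
open import Function.Bundles using (_⇔_; mk⇔)
open import Relation.Binary.PropositionalEquality
  using (_≡_; _≢_; refl; sym; trans; cong)

∑ : ∀ {a} {A : Set a} → List A → (A → ℤ) → ℤ
∑ xs f = List.foldr ℤ._+_ ℤ.0ℤ (List.map f xs)

syntax ∑ xs (λ x → e) = ∑[ x ∈ xs ] e
infix 5 ∑

∏ : ∀ {r} → Vec ℕ r → ℕ
∏ = Vec.foldr′ _*_ 1

[1⋯_] : ℕ → List ℕ
[1⋯ k ] = applyUpTo suc k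

-- All r-tuples of positive integers with sum k, each listed exactly once:
-- see ∈-compositions and compositions-unique.
compositions : (r k : ℕ) → List (Vec ℕ r)
compositions zero    zero    = [] ∷ []
compositions zero    (suc _) = []
compositions (suc r) k       =
  concatMap (λ j → List.map (j ∷_) (compositions r (k ∸ j))) [1⋯ k ]

∈-compositions : ∀ {r k} {ks : Vec ℕ r} →
                 ks ∈ compositions r k ⇔ (All (1 ≤_) ks × Vec.sum ks ≡ k)
∈-compositions = mk⇔ (to _ _) (λ (ps , eq) → from ps eq)
  where
  to : ∀ r k {ks : Vec ℕ r} → ks ∈ compositions r k → All (1 ≤_) ks × Vec.sum ks ≡ k
  to zero    zero    (here refl) = [] , refl
  to (suc r) k       p
    with find (∈-concatMap⁻ _ {xs = [1⋯ k ]} p)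
  ... | j , j∈ , q
    with ∈-applyUpTo⁻ suc j∈ | ∈-map⁻ _ q
  ... | i , i<k , refl | ks , ks∈ , refl
    with to r (k ∸ suc i) ks∈
  ... | ps , eq = s≤s z≤n ∷ ps , trans (cong (suc i +_) eq) (m+[n∸m]≡n i<k)

  from : ∀ {r k} {ks : Vec ℕ r} → All (1 ≤_) ks → Vec.sum ks ≡ k → ks ∈ compositions r k
  from []                           refl = here refl
  from {ks = suc i ∷ ks} (s≤s z≤n ∷ ps) refl =
    ∈-concatMap⁺ _ (lose (∈-applyUpTo⁺ suc (m≤m+n (suc i) (Vec.sum ks)))
      (∈-map⁺ (suc i ∷_)
        (from ps (sym (m+n∸m≡n (suc i) (Vec.sum ks))))))

compositions-unique : ∀ r k → Unique (compositions r k)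
compositions-unique zero    zero    = ListAll.[] AllPairs.∷ AllPairs.[]
compositions-unique zero    (suc _) = AllPairs.[]
compositions-unique (suc r) k       = concat⁺
  (All-map⁺ (ListAll.universal
    (λ j → Unique-map⁺ ∷-injectiveʳ (compositions-unique r (k ∸ j))) [1⋯ k ]))
  (AllPairs-map⁺ (AllPairs.map disjoint
    (applyUpTo⁺₁ suc k λ i<j _ → <⇒≢ i<j ∘ suc-injective)))
  where
  disjoint : ∀ {i j} → i ≢ j → Disjoint (List.map (i ∷_) (compositions r (k ∸ i)))
                                        (List.map (j ∷_) (compositions r (k ∸ j)))
  disjoint {i} {j} i≢j (p , q)
    with ∈-map⁻ (i ∷_) p | ∈-map⁻ (j ∷_) q
  ... | _ , _ , e | _ , _ , e′ = i≢j (∷-injectiveˡ (trans (sym e) e′))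

{-# OPTIONS --safe #-}
-- Write E and H for the coefficient sequences of (1 - x)^n and of its inverse
-- (1 - x)^(-n), so that H k = C (n + k - 1) k.  Since E = 1 - D with D 0 = 0,
-- H is the geometric series ∑ D^r, and the coefficient of x^k in D^r is the
-- signed sum over the compositions of k into r parts.  As D has no constant
-- term, the partial sum over r < N already agrees with H at every index below N.
module Submission where

import Algebra.Properties.AbelianGroup as AbelianGroupProperties
open import Defs
open import Data.Integer.Base using (ℤ; +_; -1ℤ; 0ℤ; 1ℤ; _*_; _^_) renaming (_+_ to _+ᶻ_)
import Data.Integer.Properties as ℤ
open import Data.Integer.Tactic.RingSolver using (solve-∀)
open import Data.List.Base as List using (List; []; _∷_; _++_; applyUpTo; concatMap; upTo)
open import Data.List.Membership.Propositional using (_∈_)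
open import Data.List.Membership.Propositional.Properties using (∈-upTo⁻)
open import Data.List.Relation.Unary.Any using (here; there)
open import Data.Nat.Base using (ℕ; zero; suc; _+_; _∸_; _≤_; _<_; s≤s; NonZero)
open import Data.Nat.Combinatorics using (_C_; nCk+nC[k+1]≡[n+1]C[k+1]; k>n⇒nCk≡0)
open import Data.Nat.Properties using (+-suc; m+[n∸m]≡n; m∸n≤m; ≤-pred; ≤-<-trans; ≤-refl)
open import Data.Vec.Base as Vec using (Vec; map)
open import Function.Base using (_∘_)
open import Relation.Binary.PropositionalEquality
  using (_≡_; refl; sym; trans; cong; cong₂; module ≡-Reasoning)

open ≡-Reasoning

private
  variable
    A B : Set

-- Finite sums over lists.

∑-cong : ∀ (xs : List A) {f g : A → ℤ} → (∀ {x} → x ∈ xs → f x ≡ g x) → ∑ xs f ≡ ∑ xs g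
∑-cong []       eq = refl
∑-cong (x ∷ xs) eq = cong₂ _+ᶻ_ (eq (here refl)) (∑-cong xs (eq ∘ there))

∑-zero : ∀ (xs : List A) → ∑ xs (λ _ → 0ℤ) ≡ 0ℤ
∑-zero []       = refl
∑-zero (x ∷ xs) = trans (ℤ.+-identityˡ _) (∑-zero xs)

∑-distrib-+ : ∀ (xs : List A) (f g : A → ℤ) → ∑ xs (λ x → f x +ᶻ g x) ≡ ∑ xs f +ᶻ ∑ xs g
∑-distrib-+ []       f g = refl
∑-distrib-+ (x ∷ xs) f g =
  trans (cong (f x +ᶻ g x +ᶻ_) (∑-distrib-+ xs f g)) (interchange (f x) (g x) _ _)
  where
  interchange : ∀ a b c d → (a +ᶻ b) +ᶻ (c +ᶻ d) ≡ (a +ᶻ c) +ᶻ (b +ᶻ d)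
  interchange = solve-∀

*-distribˡ-∑ : ∀ (xs : List A) c (f : A → ℤ) → c * ∑ xs f ≡ ∑ xs (λ x → c * f x)
*-distribˡ-∑ []       c f = ℤ.*-zeroʳ c
*-distribˡ-∑ (x ∷ xs) c f =
  trans (ℤ.*-distribˡ-+ c (f x) _) (cong (c * f x +ᶻ_) (*-distribˡ-∑ xs c f))

∑-swap : ∀ (xs : List A) (ys : List B) (f : A → B → ℤ) →
         ∑ xs (λ x → ∑ ys (f x)) ≡ ∑ ys (λ y → ∑ xs (λ x → f x y))
∑-swap []       ys f = sym (∑-zero ys)
∑-swap (x ∷ xs) ys f = trans (cong (∑ ys (f x) +ᶻ_) (∑-swap xs ys f)) (sym (∑-distrib-+ ys _ _))

∑-++ : ∀ (xs ys : List A) (f : A → ℤ) → ∑ (xs ++ ys) f ≡ ∑ xs f +ᶻ ∑ ys f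
∑-++ []       ys f = sym (ℤ.+-identityˡ _)
∑-++ (x ∷ xs) ys f = trans (cong (f x +ᶻ_) (∑-++ xs ys f)) (sym (ℤ.+-assoc (f x) _ _))

∑-concatMap : ∀ (g : A → List B) (xs : List A) (f : B → ℤ) →
              ∑ (concatMap g xs) f ≡ ∑ xs (λ x → ∑ (g x) f)
∑-concatMap g []       f = refl
∑-concatMap g (x ∷ xs) f =
  trans (∑-++ (g x) _ f) (cong (∑ (g x) f +ᶻ_) (∑-concatMap g xs f))

∑-map : ∀ (g : A → B) (xs : List A) (f : B → ℤ) → ∑ (List.map g xs) f ≡ ∑ xs (f ∘ g)
∑-map g []       f = refl
∑-map g (x ∷ xs) f = cong (f (g x) +ᶻ_) (∑-map g xs f)

-- Both generators stay arbitrary because the induction composes each of them with `suc`.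
∑-applyUpTo : ∀ (g h : ℕ → A) (f f′ : A → ℤ) → (∀ i → f (g i) ≡ f′ (h i)) → ∀ k →
              ∑ (applyUpTo g k) f ≡ ∑ (applyUpTo h k) f′
∑-applyUpTo g h f f′ eq zero    = refl
∑-applyUpTo g h f f′ eq (suc k) =
  cong₂ _+ᶻ_ (eq 0) (∑-applyUpTo (g ∘ suc) (h ∘ suc) f f′ (eq ∘ suc) k)

∑-[1⋯] : ∀ k (f : ℕ → ℤ) → ∑ [1⋯ k ] f ≡ ∑ (upTo k) (f ∘ suc)
∑-[1⋯] k f = ∑-applyUpTo suc (λ i → i) f (f ∘ suc) (λ _ → refl) k

-- Cauchy products of coefficient sequences.

infixl 7 _⋆_

_⋆_ : (ℕ → ℤ) → (ℕ → ℤ) → ℕ → ℤ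
(f ⋆ g) k = ∑[ j ∈ upTo (suc k) ] f j * g (k ∸ j)

⋆-suc : ∀ f g k → (f ⋆ g) (suc k) ≡ f 0 * g (suc k) +ᶻ ((f ∘ suc) ⋆ g) k
⋆-suc f g k = cong (f 0 * g (suc k) +ᶻ_) (∑-[1⋯] (suc k) (λ j → f j * g (suc k ∸ j)))

⋆-congˡ : ∀ {f f′} g k → (∀ j → f j ≡ f′ j) → (f ⋆ g) k ≡ (f′ ⋆ g) k
⋆-congˡ g k eq = ∑-cong (upTo (suc k)) λ {j} _ → cong (_* g (k ∸ j)) (eq j)

-- Agreement is asked only up to `k`, since truncations of the geometric series match `H` only at
-- small indices.
⋆-congʳ : ∀ f {g g′} k → (∀ i → i ≤ k → g i ≡ g′ i) → (f ⋆ g) k ≡ (f ⋆ g′) k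
⋆-congʳ f k eq = ∑-cong (upTo (suc k)) λ {j} _ → cong (f j *_) (eq (k ∸ j) (m∸n≤m k j))

⋆-distribʳ-+ : ∀ f f′ g k → ((λ j → f j +ᶻ f′ j) ⋆ g) k ≡ (f ⋆ g) k +ᶻ (f′ ⋆ g) k
⋆-distribʳ-+ f f′ g k = trans
  (∑-cong (upTo (suc k)) λ {j} _ → ℤ.*-distribʳ-+ (g (k ∸ j)) (f j) (f′ j))
  (∑-distrib-+ (upTo (suc k)) (λ j → f j * g (k ∸ j)) (λ j → f′ j * g (k ∸ j)))

⋆-distribˡ-+ : ∀ f g g′ k → (f ⋆ (λ j → g j +ᶻ g′ j)) k ≡ (f ⋆ g) k +ᶻ (f ⋆ g′) k
⋆-distribˡ-+ f g g′ k = trans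
  (∑-cong (upTo (suc k)) λ {j} _ → ℤ.*-distribˡ-+ (f j) (g (k ∸ j)) (g′ (k ∸ j)))
  (∑-distrib-+ (upTo (suc k)) (λ j → f j * g (k ∸ j)) (λ j → f j * g′ (k ∸ j)))

⋆-*-assoc : ∀ c f g k → ((λ j → c * f j) ⋆ g) k ≡ c * (f ⋆ g) k
⋆-*-assoc c f g k = trans
  (∑-cong (upTo (suc k)) λ {j} _ → ℤ.*-assoc c (f j) (g (k ∸ j)))
  (sym (*-distribˡ-∑ (upTo (suc k)) c _))

⋆-distribˡ-∑ : ∀ f (xs : List A) (g : A → ℕ → ℤ) k →
               (f ⋆ (λ i → ∑[ x ∈ xs ] g x i)) k ≡ (∑[ x ∈ xs ] (f ⋆ g x) k)
⋆-distribˡ-∑ f xs g k = trans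
  (∑-cong (upTo (suc k)) λ {j} _ → *-distribˡ-∑ xs (f j) _)
  (∑-swap (upTo (suc k)) xs _)

-- Multiplication of the generating function by x.
shift : (ℕ → ℤ) → ℕ → ℤ
shift f zero    = 0ℤ
shift f (suc k) = f k

shift-⋆ : ∀ f g k → (shift f ⋆ g) (suc k) ≡ (f ⋆ g) k
shift-⋆ f g k = trans (⋆-suc (shift f) g k) (ℤ.+-identityˡ _)

-- Each step peels off the term with `f 0`, so the induction ranges over all `f`.
⋆-shift : ∀ f g k → (f ⋆ shift g) (suc k) ≡ (f ⋆ g) k
⋆-shift f g zero    = cong (λ z → f 0 * g 0 +ᶻ (z +ᶻ 0ℤ)) (ℤ.*-zeroʳ (f 1))
⋆-shift f g (suc k) = begin
  (f ⋆ shift g) (suc (suc k))                         ≡⟨ ⋆-suc f (shift g) (suc k) ⟩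
  f 0 * g (suc k) +ᶻ ((f ∘ suc) ⋆ shift g) (suc k)   ≡⟨ cong (f 0 * g (suc k) +ᶻ_) (⋆-shift (f ∘ suc) g k) ⟩
  f 0 * g (suc k) +ᶻ ((f ∘ suc) ⋆ g) k               ≡⟨ ⋆-suc f g k ⟨
  (f ⋆ g) (suc k)                                     ∎

-- The binomial series of (1 - x)^n and its inverse.

E H : ℕ → ℕ → ℤ
E n j = (-1ℤ ^ j) * + (n C j)
-- Truncated subtraction makes `H 0` the sequence 1, 0, 0, ..., so induction on `n` can start at
-- zero.
H n k = + ((n + k ∸ 1) C k)

-- Pascal's rule, read as (1 - x)^n = (1 - x)^(n + 1) + x (1 - x)^n.
E-suc : ∀ n j → E n j ≡ E (suc n) j +ᶻ shift (E n) j
E-suc n zero    = refl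
E-suc n (suc j) = begin
  E n (suc j)
    ≡⟨ lemma (-1ℤ ^ j) (+ (n C j)) (+ (n C suc j)) ⟩
  (-1ℤ ^ suc j) * (+ (n C j) +ᶻ + (n C suc j)) +ᶻ E n j
    ≡⟨ cong (λ z → (-1ℤ ^ suc j) * z +ᶻ E n j) (cong +_ (nCk+nC[k+1]≡[n+1]C[k+1] n j)) ⟩
  E (suc n) (suc j) +ᶻ E n j
    ∎
  where
  lemma : ∀ s a b → (-1ℤ * s) * b ≡ (-1ℤ * s) * (a +ᶻ b) +ᶻ s * a
  lemma = solve-∀

H-suc : ∀ n k → H (suc n) k ≡ H n k +ᶻ shift (H (suc n)) k
H-suc n zero    = refl
-- Exposing the successor lets `∸ 1` reduce, so that Pascal's rule applies.
H-suc n (suc k) rewrite +-suc n k =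
  trans (cong +_ (sym (nCk+nC[k+1]≡[n+1]C[k+1] (n + k) k))) (ℤ.+-comm (+ ((n + k) C k)) (+ ((n + k) C suc k)))

-- Past its constant term the product (1 - x)^n (1 - x)^(-n) = 1 vanishes. The induction on `n`
-- cancels a mixed product.
E⋆H≡0 : ∀ n k → (E n ⋆ H n) (suc k) ≡ 0ℤ
E⋆H≡0 zero k = begin
  (E 0 ⋆ H 0) (suc k)                          ≡⟨ ⋆-suc (E 0) (H 0) k ⟩
  1ℤ * H 0 (suc k) +ᶻ ((E 0 ∘ suc) ⋆ H 0) k   ≡⟨ cong₂ (λ x y → 1ℤ * + x +ᶻ y) (k>n⇒nCk≡0 {k} {suc k} ≤-refl) vanish ⟩
  0ℤ                                           ∎
  where
  vanish : ((E 0 ∘ suc) ⋆ H 0) k ≡ 0ℤ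
  vanish = trans
    (∑-cong (upTo (suc k)) λ {j} _ → cong (_* H 0 (k ∸ j)) (ℤ.*-zeroʳ (-1ℤ ^ suc j)))
    (∑-zero (upTo (suc k)))
E⋆H≡0 (suc n) k = trans (∙-cancelʳ ((E n ⋆ H (suc n)) k) _ _ eq) (E⋆H≡0 n k)
  where
  open AbelianGroupProperties ℤ.+-0-abelianGroup using (∙-cancelʳ)

  -- Both sides are the coefficient of E n ⋆ H (suc n), as
  -- E n = E (suc n) + x E n and H (suc n) = H n + x H (suc n).
  eq : (E (suc n) ⋆ H (suc n)) (suc k) +ᶻ (E n ⋆ H (suc n)) k ≡
       (E n ⋆ H n) (suc k) +ᶻ (E n ⋆ H (suc n)) k
  eq = begin
    (E (suc n) ⋆ H (suc n)) (suc k) +ᶻ (E n ⋆ H (suc n)) k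
      ≡⟨ cong ((E (suc n) ⋆ H (suc n)) (suc k) +ᶻ_) (shift-⋆ (E n) (H (suc n)) k) ⟨
    (E (suc n) ⋆ H (suc n)) (suc k) +ᶻ (shift (E n) ⋆ H (suc n)) (suc k)
      ≡⟨ ⋆-distribʳ-+ (E (suc n)) (shift (E n)) (H (suc n)) (suc k) ⟨
    ((λ j → E (suc n) j +ᶻ shift (E n) j) ⋆ H (suc n)) (suc k)
      ≡⟨ ⋆-congˡ (H (suc n)) (suc k) (E-suc n) ⟨
    (E n ⋆ H (suc n)) (suc k)
      ≡⟨ ⋆-congʳ (E n) (suc k) (λ i _ → H-suc n i) ⟩
    (E n ⋆ (λ j → H n j +ᶻ shift (H (suc n)) j)) (suc k)
      ≡⟨ ⋆-distribˡ-+ (E n) (H n) (shift (H (suc n))) (suc k) ⟩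
    (E n ⋆ H n) (suc k) +ᶻ (E n ⋆ shift (H (suc n))) (suc k)
      ≡⟨ cong ((E n ⋆ H n) (suc k) +ᶻ_) (⋆-shift (E n) (H (suc n)) k) ⟩
    (E n ⋆ H n) (suc k) +ᶻ (E n ⋆ H (suc n)) k
      ∎

-- D n j is the coefficient of x^(j + 1) in 1 - (1 - x)^n.
D : ℕ → ℕ → ℤ
D n j = (-1ℤ ^ j) * + (n C suc j)

-- As (1 - x)^n = 1 - x D, the relation E H = 1 becomes H = 1 + x D H.
H≡D⋆H : ∀ n k → H n (suc k) ≡ (D n ⋆ H n) k
H≡D⋆H n k = begin
  H n (suc k)
    ≡⟨ rearrange (H n (suc k)) ((D n ⋆ H n) k) ⟩
  (1ℤ * H n (suc k) +ᶻ -1ℤ * (D n ⋆ H n) k) +ᶻ (D n ⋆ H n) k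
    ≡⟨ cong (λ z → (1ℤ * H n (suc k) +ᶻ z) +ᶻ (D n ⋆ H n) k) E∘suc⋆H ⟨
  (1ℤ * H n (suc k) +ᶻ ((E n ∘ suc) ⋆ H n) k) +ᶻ (D n ⋆ H n) k
    ≡⟨ cong (_+ᶻ (D n ⋆ H n) k) (⋆-suc (E n) (H n) k) ⟨
  (E n ⋆ H n) (suc k) +ᶻ (D n ⋆ H n) k
    ≡⟨ cong (_+ᶻ (D n ⋆ H n) k) (E⋆H≡0 n k) ⟩
  0ℤ +ᶻ (D n ⋆ H n) k
    ≡⟨ ℤ.+-identityˡ _ ⟩
  (D n ⋆ H n) k
    ∎
  where
  rearrange : ∀ a b → a ≡ (1ℤ * a +ᶻ -1ℤ * b) +ᶻ b
  rearrange = solve-∀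

  E∘suc⋆H : ((E n ∘ suc) ⋆ H n) k ≡ -1ℤ * (D n ⋆ H n) k
  E∘suc⋆H = trans
    (⋆-congˡ (H n) k λ j → ℤ.*-assoc -1ℤ (-1ℤ ^ j) (+ (n C suc j)))
    (⋆-*-assoc -1ℤ (D n) (H n) k)

-- Signed sums over compositions and the geometric series.

S : ℕ → ℕ → ℕ → ℤ
S n r k = ∑[ ks ∈ compositions r k ] + ∏ (map (n C_) ks)

-- `S n r k` is the coefficient of x^k in ((1 + x)^n - 1)^r; splitting off the first part, `suc j`,
-- splits off one factor.
S-suc : ∀ n r k → S n (suc r) (suc k) ≡ (∑[ j ∈ upTo (suc k) ] + (n C suc j) * S n r (k ∸ j))
S-suc n r k = begin
  S n (suc r) (suc k)
    ≡⟨ ∑-concatMap (λ j → List.map (j Vec.∷_) (compositions r (suc k ∸ j))) [1⋯ suc k ] weight ⟩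
  (∑[ j ∈ [1⋯ suc k ] ] ∑ (List.map (j Vec.∷_) (compositions r (suc k ∸ j))) weight)
    ≡⟨ ∑-[1⋯] (suc k) (λ j → ∑ (List.map (j Vec.∷_) (compositions r (suc k ∸ j))) weight) ⟩
  (∑[ j ∈ upTo (suc k) ] ∑ (List.map (suc j Vec.∷_) (compositions r (k ∸ j))) weight)
    ≡⟨ ∑-cong (upTo (suc k)) (λ {j} _ → first-part j) ⟩
  (∑[ j ∈ upTo (suc k) ] + (n C suc j) * S n r (k ∸ j))
    ∎
  where
  weight : ∀ {r} → Vec ℕ r → ℤ
  weight ks = + ∏ (map (n C_) ks)

  first-part : ∀ j → ∑ (List.map (suc j Vec.∷_) (compositions r (k ∸ j))) weight ≡
                     + (n C suc j) * S n r (k ∸ j)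
  first-part j = begin
    ∑ (List.map (suc j Vec.∷_) (compositions r (k ∸ j))) weight
      ≡⟨ ∑-map (suc j Vec.∷_) (compositions r (k ∸ j)) weight ⟩
    (∑[ ks ∈ compositions r (k ∸ j) ] weight (suc j Vec.∷ ks))
      ≡⟨ ∑-cong (compositions r (k ∸ j)) (λ {ks} _ → ℤ.pos-* (n C suc j) (∏ (map (n C_) ks))) ⟩
    (∑[ ks ∈ compositions r (k ∸ j) ] + (n C suc j) * weight ks)
      ≡⟨ *-distribˡ-∑ (compositions r (k ∸ j)) (+ (n C suc j)) weight ⟨
    + (n C suc j) * S n r (k ∸ j)
      ∎

^-∸ : ∀ i {k j} → j ≤ k → i ^ k ≡ i ^ j * i ^ (k ∸ j)
^-∸ i {k} {j} j≤k = trans (cong (i ^_) (sym (m+[n∸m]≡n j≤k))) (ℤ.^-distribˡ-+-* i j (k ∸ j))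

-- The sign is (-1)^(k + r), which unlike (-1)^(k ∸ r) is also correct for r > k.
P : ℕ → ℕ → ℕ → ℤ
P n r k = (-1ℤ ^ k * -1ℤ ^ r) * S n r k

-- `P n r` lists the coefficients of (1 - (1 - x)^n)^r, and one more factor x D raises both indices
-- by one.
P-suc : ∀ n r k → P n (suc r) (suc k) ≡ (D n ⋆ P n r) k
P-suc n r k = begin
  P n (suc r) (suc k)
    ≡⟨ cong₂ _*_ (signs (-1ℤ ^ k) (-1ℤ ^ r)) (S-suc n r k) ⟩
  (-1ℤ ^ k * -1ℤ ^ r) * (∑[ j ∈ upTo (suc k) ] + (n C suc j) * S n r (k ∸ j))
    ≡⟨ *-distribˡ-∑ (upTo (suc k)) (-1ℤ ^ k * -1ℤ ^ r) _ ⟩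
  (∑[ j ∈ upTo (suc k) ] (-1ℤ ^ k * -1ℤ ^ r) * (+ (n C suc j) * S n r (k ∸ j)))
    -- Membership gives j ≤ k, which allows (-1)^k to be split between the indices j and k ∸ j.
    ≡⟨ ∑-cong (upTo (suc k)) (λ {j} j∈ → split j (≤-pred (∈-upTo⁻ j∈))) ⟩
  (D n ⋆ P n r) k
    ∎
  where
  signs : ∀ a b → (-1ℤ * a) * (-1ℤ * b) ≡ a * b
  signs = solve-∀

  regroup : ∀ a b c d e → ((a * b) * c) * (d * e) ≡ (a * d) * ((b * c) * e)
  regroup = solve-∀

  split : ∀ j → j ≤ k → (-1ℤ ^ k * -1ℤ ^ r) * (+ (n C suc j) * S n r (k ∸ j)) ≡
                        D n j * P n r (k ∸ j)
  split j j≤k = trans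
    (cong (λ s → (s * -1ℤ ^ r) * (+ (n C suc j) * S n r (k ∸ j))) (^-∸ -1ℤ j≤k))
    (regroup (-1ℤ ^ j) (-1ℤ ^ (k ∸ j)) (-1ℤ ^ r) (+ (n C suc j)) (S n r (k ∸ j)))

-- Induction on `N` along H = 1 + x D H. For k < N the powers of x D from the N-th on do not reach
-- x^k.
∑P≡H : ∀ n N k → k < N → (∑[ r ∈ upTo N ] P n r k) ≡ H n k
-- Only r = 0 contributes: the empty composition has weight 1, and 0 has no composition into one or
-- more parts.
∑P≡H n (suc N) zero    _         = cong (λ z → 1ℤ +ᶻ z) (trans
  (∑-[1⋯] N (λ r → P n r 0))
  (trans (∑-cong (upTo N) λ {r} _ → ℤ.*-zeroʳ (-1ℤ ^ 0 * -1ℤ ^ suc r)) (∑-zero (upTo N))))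
∑P≡H n (suc N) (suc k) (s≤s k<N) = begin
  P n 0 (suc k) +ᶻ (∑[ r ∈ [1⋯ N ] ] P n r (suc k))
    -- No composition of `suc k` has zero parts, so the term r = 0 vanishes.
    ≡⟨ cong₂ _+ᶻ_ (ℤ.*-zeroʳ (-1ℤ ^ suc k * 1ℤ)) (∑-[1⋯] N (λ r → P n r (suc k))) ⟩
  0ℤ +ᶻ (∑[ r ∈ upTo N ] P n (suc r) (suc k))
    ≡⟨ ℤ.+-identityˡ _ ⟩
  (∑[ r ∈ upTo N ] P n (suc r) (suc k))
    ≡⟨ ∑-cong (upTo N) (λ {r} _ → P-suc n r k) ⟩
  (∑[ r ∈ upTo N ] (D n ⋆ P n r) k)
    ≡⟨ ⋆-distribˡ-∑ (D n) (upTo N) (P n) k ⟨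
  (D n ⋆ (λ i → ∑[ r ∈ upTo N ] P n r i)) k
    ≡⟨ ⋆-congʳ (D n) k (λ i i≤k → ∑P≡H n N i (≤-<-trans i≤k k<N)) ⟩
  (D n ⋆ H n) k
    ≡⟨ H≡D⋆H n k ⟨
  H n (suc k)
    ∎

-- Since (-1)^r squares to 1, dividing by it is multiplying by it.
-1^-∸ : ∀ {r k} → r ≤ k → -1ℤ ^ (k ∸ r) ≡ -1ℤ ^ k * -1ℤ ^ r
-1^-∸ {r} {k} r≤k = begin
  -1ℤ ^ (k ∸ r)                           ≡⟨ ℤ.*-identityˡ _ ⟨
  1ℤ * -1ℤ ^ (k ∸ r)                      ≡⟨ cong (_* -1ℤ ^ (k ∸ r)) (square r) ⟨
  (-1ℤ ^ r * -1ℤ ^ r) * -1ℤ ^ (k ∸ r)     ≡⟨ regroup (-1ℤ ^ r) (-1ℤ ^ (k ∸ r)) ⟩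
  (-1ℤ ^ r * -1ℤ ^ (k ∸ r)) * -1ℤ ^ r     ≡⟨ cong (_* -1ℤ ^ r) (^-∸ -1ℤ r≤k) ⟨
  -1ℤ ^ k * -1ℤ ^ r                       ∎
  where
  regroup : ∀ a b → (a * a) * b ≡ (a * b) * a
  regroup = solve-∀

  signs : ∀ a → (-1ℤ * a) * (-1ℤ * a) ≡ a * a
  signs = solve-∀

  square : ∀ m → -1ℤ ^ m * -1ℤ ^ m ≡ 1ℤ
  square zero    = refl
  square (suc m) = trans (signs (-1ℤ ^ m)) (square m)

theorem3 : ∀ (n k : ℕ) → .{{_ : NonZero n}} → .{{_ : NonZero k}} →
    (∑[ r ∈ [1⋯ k ] ] (-1ℤ ^ (k ∸ r)) * (∑[ ks ∈ compositions r k ] + ∏ (map (n C_) ks)))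
    ≡ + ((n + k ∸ 1) C k)
theorem3 n k@(suc _) = begin
  (∑[ r ∈ [1⋯ k ] ] (-1ℤ ^ (k ∸ r)) * S n r k)
    ≡⟨ ∑-cong [1⋯ k ] (λ {r} r∈ → cong (_* S n r k) (-1^-∸ (bound r∈))) ⟩
  (∑[ r ∈ [1⋯ k ] ] P n r k)
    -- The vanishing term r = 0 is put in front, so that the range becomes `upTo (suc k)`.
    ≡⟨ ℤ.+-identityˡ _ ⟨
  0ℤ +ᶻ (∑[ r ∈ [1⋯ k ] ] P n r k)
    ≡⟨ cong (_+ᶻ (∑[ r ∈ [1⋯ k ] ] P n r k)) (ℤ.*-zeroʳ (-1ℤ ^ k * 1ℤ)) ⟨
  (∑[ r ∈ upTo (suc k) ] P n r k)
    ≡⟨ ∑P≡H n (suc k) k ≤-refl ⟩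
  + ((n + k ∸ 1) C k)
    ∎
  where
  bound : ∀ {r} → r ∈ [1⋯ k ] → r ≤ k
  -- `[1⋯ k ]` is the tail of `upTo (suc k)`, hence the `there`.
  bound r∈ = ≤-pred (∈-upTo⁻ (there r∈))
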